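{- Let $H = (V, A, B)$ be an $n$-uniform cross-intersecting family. Then $\chi(H) \leq 3$, or $n = 2$ and $H = K_4$ (the complete graph on four vertices).
   Context: A hypergraph is a pair $(V,E)$ where $V$ is a set of vertices and $E$ is a set of subsets of $V$ (edges); it is $n$-uniform if every edge has exactly $n$ vertices. A cross-intersecting family $H = (V, A, B)$ is a hypergraph with vertex set $V$ and edge set $E = A \cup B$ such that every $a \in A$ intersects every $b \in B$, and $A$, $B$ are not empty. A coloring of the vertices is proper if there are no monochromatic edges; the chromatic number $\chi(H)$ is the minimal number of colors that admits a proper coloring.
   Formalization: Assumes n ≥ 2 (for n = 1 no proper coloring exists), and "H = K_4" is read as isomorphism after deleting isolated vertices of H, since K_4 plus an isolated vertex is a cross-intersecting family with chromatic number 4. -}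

module Defs where

open import Data.Fin using (Fin)
open import Data.List using (List; length)
open import Data.List.Membership.Propositional using () renaming (_∈_ to _∈ˡ_)
open import Data.List.Relation.Unary.Unique.Propositional using (Unique)
open import Data.Nat using (ℕ; _≤_)
open import Data.Product using (∃; _×_; _,_)
open import Data.Sum using (map)
open import Function.Bundles using (_⇔_)
open import Function.Definitions using (Injective)
open import Level using (0ℓ; suc)
open import Relation.Binary.Definitions using (_Respects_)
open import Relation.Binary.PropositionalEquality using (_≡_)
open import Relation.Nullary using (¬_)
open import Relation.Unary using (Pred; _∈_; _∪_; _≐_; _≬_; Satisfiable)

HasSize : {V : Set} → ℕ → Pred V 0ℓ → Set
HasSize n e = ∃ λ xs → Unique xs × length xs ≡ n × e ≐ (_∈ˡ xs)

Image : {V W : Set} → (V → W) → Pred V 0ℓ → Pred W 0ℓ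
Image φ e w = ∃ λ v → v ∈ e × φ v ≡ w

-- A set of edges is a predicate on predicates; E-resp makes it depend only on
-- the extension of an edge.  The vertex set may be infinite.
record Hypergraph : Set₁ where
  field
    V      : Set
    E      : Pred (Pred V 0ℓ) 0ℓ
    E-resp : E Respects _≐_

open Hypergraph public using (V; E)

Uniform : ℕ → Hypergraph → Set₁
Uniform n H = ∀ {e} → e ∈ E H → HasSize n e

record CrossIntersectingFamily : Set₁ where
  field
    Vertex     : Set
    A B        : Pred (Pred Vertex 0ℓ) 0ℓ
    A-resp     : A Respects _≐_
    B-resp     : B Respects _≐_
    A-nonempty : Satisfiable A
    B-nonempty : Satisfiable B
    cross      : ∀ {a b} → a ∈ A → b ∈ B → a ≬ b

  hypergraph : Hypergraph
  hypergraph = record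
    { V      = Vertex
    ; E      = A ∪ B
    ; E-resp = λ e≐f → map (A-resp e≐f) (B-resp e≐f)
    }

open CrossIntersectingFamily public using (hypergraph)

Monochromatic : {V : Set} {k : ℕ} → (V → Fin k) → Pred V 0ℓ → Set
Monochromatic c e = ∀ {u v} → u ∈ e → v ∈ e → c u ≡ c v

Proper : (H : Hypergraph) {k : ℕ} → (V H → Fin k) → Set₁
Proper H c = ∀ {e} → e ∈ E H → ¬ Monochromatic c e

Colorable : Hypergraph → ℕ → Set₁
Colorable H k = ∃ λ (c : V H → Fin k) → Proper H c

IsChromaticNumber : Hypergraph → ℕ → Set₁
IsChromaticNumber H k = Colorable H k × (∀ {j} → Colorable H j → k ≤ j)

-- The chromatic number is a partial function of H (an edge with at most one
-- vertex admits no proper coloring), so a bound on it includes its existence.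
χ[_]≤_ : Hypergraph → ℕ → Set₁
χ[ H ]≤ m = ∃ λ k → IsChromaticNumber H k × k ≤ m

Complete : ℕ → Hypergraph
Complete k = record
  { V      = Fin k
  ; E      = HasSize 2
  ; E-resp = λ { (e⊆f , f⊆e) (xs , u , l , (e⊆xs , xs⊆e)) →
      xs , u , l , ((λ v∈f → e⊆xs (f⊆e v∈f)) , (λ v∈xs → e⊆f (xs⊆e v∈xs))) }
  }

Covered : (H : Hypergraph) → Pred (V H) (suc 0ℓ)
Covered H v = ∃ λ e → e ∈ E H × v ∈ e

-- H becomes isomorphic to G once the isolated vertices of H (those lying in no
-- edge) are deleted: `to` is a bijection from the vertices of G onto the
-- non-isolated vertices of H, carrying the edges of G exactly to those of H.
-- If H has no isolated vertices this is an isomorphism of hypergraphs.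
record _EqualsUpToIsolatedVertices_ (H G : Hypergraph) : Set₁ where
  field
    to        : V G → V H
    injective : Injective _≡_ _≡_ to
    range     : ∀ v → Covered H v ⇔ (∃ λ u → to u ≡ v)
    edges     : ∀ f → f ∈ E G ⇔ Image to f ∈ E H

{-# OPTIONS --safe #-}

-- Suppose H has no proper 3-coloring.  Whenever p and q are sets of vertices
-- such that every edge meets p ∪ q, giving color 0 to p, color 1 to q ∖ p and
-- color 2 to the rest shows that p or q contains an edge.  For a ∈ A and b ∈ B
-- every edge meets a ∪ b, so a ∪ b cannot be covered by two sets with fewer
-- than n elements; hence a and b share exactly one vertex v, and every n-subset
-- of the (2n − 1)-set a ∪ b is an edge.  For n ≥ 3 some n-subset contains v, a
-- further vertex of a and a further vertex of b, so it can lie neither in A nor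
-- in B.  For n = 2, a, b and the third pair in a ∪ b form a triangle of edges,
-- and cross-intersection confines all edges to that triangle and one more vertex;
-- since for any two vertices some edge avoids both, all six pairs are edges.
module Submission where

open import Defs
open import Axiom.ExcludedMiddle using (ExcludedMiddle)
open import Data.Empty using (⊥; ⊥-elim)
open import Data.Fin using (Fin; zero)
open import Data.Fin.Properties using (all?; any?; punchInᵢ≢i) renaming (_≟_ to _≟ᶠ_)
open import Data.List using (List; []; _∷_; [_]; _++_; length; lookup)
open import Data.List.Membership.DecPropositional using (_∈?_)
open import Data.List.Membership.Propositional using () renaming (_∈_ to _∈ˡ_)
open import Data.List.Membership.Propositional.Properties
  using (∈-∃++; ∈-++⁺ˡ; ∈-++⁺ʳ; ∈-++⁻; ∈-lookup)
open import Data.List.Relation.Binary.Permutation.Propositional using (_↭_; ↭-sym; ↭⇒↭ₛ)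
open import Data.List.Relation.Binary.Permutation.Propositional.Properties
  using (shift; ∈-resp-↭; ↭-length)
open import Data.List.Relation.Binary.Permutation.Setoid.Properties using (Unique-resp-↭)
open import Data.List.Relation.Unary.All using ([]; _∷_) renaming (lookup to All-lookup)
open import Data.List.Relation.Unary.All.Properties using (¬Any⇒All¬)
open import Data.List.Relation.Unary.AllPairs using ([]; _∷_)
open import Data.List.Relation.Unary.Any using (here; there; index)
open import Data.List.Relation.Unary.Any.Properties using (lookup-index)
open import Data.List.Relation.Unary.Unique.Propositional using (Unique)
open import Data.Nat using (ℕ; zero; _+_; _≤_; _<_; z≤n; s≤s)
open import Data.Nat.Induction using (<-rec)
open import Data.Nat.Properties
  using (≤-refl; ≤-reflexive; ≤-trans; <⇒≤; <⇒≱; suc-injective; ≮⇒≥)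
open import Data.Product using (∃; _×_; _,_; proj₁)
open import Data.Sum using (_⊎_; inj₁; inj₂; [_,_]′) renaming (swap to ⊎-swap)
open import Function using (_∘_)
open import Function.Bundles using (mk⇔)
open import Level using (0ℓ; suc; lift; lower)
open import Relation.Binary.Definitions using (DecidableEquality)
open import Relation.Binary.PropositionalEquality
  using (_≡_; _≢_; refl; sym; trans; cong; subst; setoid)
open import Relation.Nullary using (Dec; yes; no; ¬_)
open import Relation.Nullary.Decidable using (map′; from-yes; ¬?; _→-dec_)
open import Relation.Unary using (Pred; _∈_; _∉_; _⊆_; _≐_; _≬_)

private
  variable
    X : Set
    n : ℕ
    e : Pred X 0ℓ
    s t u v : X
    xs ys : List X

-- Duplicate-free lists and sets of known size.

∈-∃↭ : v ∈ˡ xs → ∃ λ zs → xs ↭ v ∷ zs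
∈-∃↭ v∈xs with ∈-∃++ v∈xs
... | ys , zs , refl = ys ++ zs , shift _ ys zs

unique-⊆⇒length≤ : Unique xs → (_∈ˡ xs) ⊆ (_∈ˡ ys) → length xs ≤ length ys
unique-⊆⇒length≤ [] _ = z≤n
unique-⊆⇒length≤ {xs = x ∷ xs} (x∉xs ∷ xs!) sub with ∈-∃↭ (sub (here refl))
... | zs , ys↭x∷zs = ≤-trans (s≤s (unique-⊆⇒length≤ xs! sub′)) (≤-reflexive (sym (↭-length ys↭x∷zs)))
  where
  sub′ : (_∈ˡ xs) ⊆ (_∈ˡ zs)
  sub′ w∈xs with ∈-resp-↭ ys↭x∷zs (sub (there w∈xs))
  ... | here refl  = ⊥-elim (All-lookup x∉xs w∈xs refl)
  ... | there w∈zs = w∈zs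

-- An entry `w` of `ys` missing from `xs` could be put in front of `xs`, giving a duplicate-free
-- list inside `ys` that is too long.
unique-⊆-length≥⇒⊇ : DecidableEquality X → {xs ys : List X} → Unique xs →
  (_∈ˡ xs) ⊆ (_∈ˡ ys) → length ys ≤ length xs → (_∈ˡ ys) ⊆ (_∈ˡ xs)
unique-⊆-length≥⇒⊇ _≟_ {xs} {ys} xs! sub ys≤xs {w} w∈ys with _∈?_ _≟_ w xs
... | yes w∈xs = w∈xs
... | no  w∉xs = ⊥-elim (<⇒≱ (unique-⊆⇒length≤ (¬Any⇒All¬ xs w∉xs ∷ xs!) sub′) ys≤xs)
  where
  sub′ : (_∈ˡ w ∷ xs) ⊆ (_∈ˡ ys)
  sub′ (here refl)  = w∈ys
  sub′ (there v∈xs) = sub v∈xs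

unique⇒lookup-injective : Unique xs → ∀ i j → lookup xs i ≡ lookup xs j → i ≡ j
unique⇒lookup-injective (_ ∷ _) zero zero _ = refl
unique⇒lookup-injective (x∉xs ∷ _) zero (Fin.suc j) eq =
  ⊥-elim (All-lookup x∉xs (∈-lookup j) eq)
unique⇒lookup-injective (x∉xs ∷ _) (Fin.suc i) zero eq =
  ⊥-elim (All-lookup x∉xs (∈-lookup i) (sym eq))
unique⇒lookup-injective (_ ∷ xs!) (Fin.suc i) (Fin.suc j) eq =
  cong Fin.suc (unique⇒lookup-injective xs! i j eq)

hasSize-split : HasSize (1 + n) e → v ∈ e →
  ∃ λ zs → Unique (v ∷ zs) × length zs ≡ n × e ≐ (_∈ˡ v ∷ zs)
hasSize-split (xs , xs! , len , (e⊆xs , xs⊆e)) v∈e with ∈-∃↭ (e⊆xs v∈e)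
... | zs , xs↭v∷zs =
  zs , Unique-resp-↭ (setoid _) (↭⇒↭ₛ xs↭v∷zs) xs! ,
  suc-injective (trans (sym (↭-length xs↭v∷zs)) len) ,
  ((∈-resp-↭ xs↭v∷zs ∘ e⊆xs) , (xs⊆e ∘ ∈-resp-↭ (↭-sym xs↭v∷zs)))

hasSize-⊆⇒≤length : HasSize n e → e ⊆ (_∈ˡ ys) → n ≤ length ys
hasSize-⊆⇒≤length (xs , xs! , refl , (_ , xs⊆e)) sub = unique-⊆⇒length≤ xs! (sub ∘ xs⊆e)

hasSize-⊆⇒⊇ : DecidableEquality X → {e : Pred X 0ℓ} {ys : List X} →
  HasSize (length ys) e → e ⊆ (_∈ˡ ys) → (_∈ˡ ys) ⊆ e
hasSize-⊆⇒⊇ _≟_ (xs , xs! , len , (_ , xs⊆e)) sub =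
  xs⊆e ∘ unique-⊆-length≥⇒⊇ _≟_ xs! (sub ∘ xs⊆e) (≤-reflexive (sym len))

hasSize2-≐ : DecidableEquality X → {e : Pred X 0ℓ} → HasSize 2 e →
  s ∈ e → t ∈ e → s ≢ t → e ≐ (_∈ˡ s ∷ t ∷ [])
hasSize2-≐ {s = s} {t} _≟_ {e} (xs , xs! , len , (e⊆xs , xs⊆e)) s∈e t∈e s≢t =
  (unique-⊆-length≥⇒⊇ _≟_ ((s≢t ∷ []) ∷ [] ∷ []) (e⊆xs ∘ sub) (≤-reflexive len) ∘ e⊆xs) , sub
  where
  sub : (_∈ˡ s ∷ t ∷ []) ⊆ e
  sub (here refl)         = s∈e
  sub (there (here refl)) = t∈e

-- Three-colorings built from two lists of vertices.

splitColor : {P Q : Set} → Dec P → Dec Q → Fin 3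
splitColor (yes _) _       = zero
splitColor (no _)  (yes _) = Fin.suc zero
splitColor (no _)  (no _)  = Fin.suc (Fin.suc zero)

splitColor-≡₁ : {P Q P′ Q′ : Set} (p : Dec P) (q : Dec Q) (p′ : Dec P′) (q′ : Dec Q′) →
  splitColor p q ≡ splitColor p′ q′ → P → P′
splitColor-≡₁ _       _       (yes p′) _       _  _ = p′
splitColor-≡₁ (yes _) _       (no _)   (yes _) () _
splitColor-≡₁ (yes _) _       (no _)   (no _)  () _
splitColor-≡₁ (no ¬p) _       (no _)   _       _  p = ⊥-elim (¬p p)

splitColor-≡₂ : {P Q P′ Q′ : Set} (p : Dec P) (q : Dec Q) (p′ : Dec P′) (q′ : Dec Q′) →
  splitColor p q ≡ splitColor p′ q′ → ¬ P → Q → Q′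
splitColor-≡₂ (yes p) _       _        _        _  ¬p _ = ⊥-elim (¬p p)
splitColor-≡₂ (no _)  (no ¬q) _        _        _  _  q = ⊥-elim (¬q q)
splitColor-≡₂ (no _)  (yes _) _        (yes q′) _  _  _ = q′
splitColor-≡₂ (no _)  (yes _) (yes _)  (no _)   () _  _
splitColor-≡₂ (no _)  (yes _) (no _)   (no _)   () _  _

-- A monochromatic edge has a vertex `v` in `p ++ q`. If `v` is in `p`, the whole edge has color 0
-- and lies in `p`; otherwise it has color 1 and lies in `q`.
split-colorable : (H : Hypergraph) → DecidableEquality (V H) → (p q : List (V H)) →
  (∀ {e} → e ∈ E H → e ≬ (_∈ˡ p ++ q)) →
  (∀ {e} → e ∈ E H → ¬ e ⊆ (_∈ˡ p)) → (∀ {e} → e ∈ E H → ¬ e ⊆ (_∈ˡ q)) →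
  Colorable H 3
split-colorable H _≟_ p q meets e⊈p e⊈q = (λ v → splitColor (v ∈ₗ? p) (v ∈ₗ? q)) , proper
  where
  _∈ₗ?_ = _∈?_ _≟_

  proper : Proper H (λ v → splitColor (v ∈ₗ? p) (v ∈ₗ? q))
  proper e∈E mono with meets e∈E
  ... | v , v∈e , v∈p++q with v ∈ₗ? p
  ...   | yes v∈p = e⊈p e∈E λ {u} u∈e →
          splitColor-≡₁ (v ∈ₗ? p) (v ∈ₗ? q) (u ∈ₗ? p) (u ∈ₗ? q) (mono v∈e u∈e) v∈p
  ...   | no  v∉p = e⊈q e∈E λ {u} u∈e →
          splitColor-≡₂ (v ∈ₗ? p) (v ∈ₗ? q) (u ∈ₗ? p) (u ∈ₗ? q) (mono v∈e u∈e) v∉p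
            ([ ⊥-elim ∘ v∉p , (λ v∈q → v∈q) ]′ (∈-++⁻ p v∈p++q))

-- Exchanging the two sides, and pairs among four vertices.

swap : CrossIntersectingFamily → CrossIntersectingFamily
swap H = record
  { Vertex     = Vertex
  ; A          = B
  ; B          = A
  ; A-resp     = B-resp
  ; B-resp     = A-resp
  ; A-nonempty = B-nonempty
  ; B-nonempty = A-nonempty
  ; cross      = λ b∈B a∈A → let v , v∈a , v∈b = cross a∈A b∈B in v , v∈b , v∈a
  }
  where open CrossIntersectingFamily H

-- This only confines the edges; that all six pairs are edges follows later from `edgeAvoiding`.
SupportedOnFour : Hypergraph → Set₁
SupportedOnFour H =
  ∃ λ ws → Unique ws × length ws ≡ 4 × (∀ {e} → e ∈ E H → e ⊆ (_∈ˡ ws))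

-- Checked by search over `Fin 4`. An edge on four vertices that avoids `k` and `l` has only `i` and
-- `j` left.
complementaryPair : ∀ (i j : Fin 4) → i ≢ j →
  ∃ λ k → ∃ λ l → ∀ m → m ∈ˡ i ∷ j ∷ k ∷ l ∷ []
complementaryPair = from-yes
  (all? λ (i : Fin 4) → all? λ j → ¬? (i ≟ᶠ j) →-dec
    any? λ k → any? λ l → all? λ m → _∈?_ _≟ᶠ_ m (i ∷ j ∷ k ∷ l ∷ []))

-- Classical logic and existence of the chromatic number.

module Classical (em : ExcludedMiddle (suc 0ℓ)) where

  em₀ : ExcludedMiddle 0ℓ
  em₀ = map′ lower lift em

  _≟_ : DecidableEquality X
  _ ≟ _ = em₀

  -- Descent: if fewer than `m` colors suffice, recurse there; if not, `m` itself is the chromatic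
  -- number.
  colorable⇒χ≤ : (H : Hypergraph) (m : ℕ) → Colorable H m → χ[ H ]≤ m
  colorable⇒χ≤ H = <-rec (λ m → Colorable H m → χ[ H ]≤ m) step
    where
    step : ∀ m → (∀ {j} → j < m → Colorable H j → χ[ H ]≤ j) → Colorable H m → χ[ H ]≤ m
    step m rec col with em {P = ∃ λ j → j < m × Colorable H j}
    ... | yes (j , j<m , colⱼ) = let k , χ≡k , k≤j = rec j<m colⱼ in k , χ≡k , ≤-trans k≤j (<⇒≤ j<m)
    ... | no  minimal = m , (col , λ {j} colⱼ → ≮⇒≥ λ j<m → minimal (j , j<m , colⱼ)) , ≤-refl

  -- Families without a proper 3-coloring.

  module NotColorable (n : ℕ) (H : CrossIntersectingFamily)
    (uniform : Uniform n (hypergraph H)) (¬colorable : ¬ Colorable (hypergraph H) 3) where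

    open CrossIntersectingFamily H hiding (hypergraph)

    private
      variable
        a b : Pred Vertex 0ℓ

    -- `q` is too short to contain an edge, so if `p` contained none either, `split-colorable` would
    -- give a 3-coloring.
    edge⊆ : (p q : List Vertex) → (∀ {e} → e ∈ E (hypergraph H) → e ≬ (_∈ˡ p ++ q)) →
      length q < n → ∃ λ e → e ∈ E (hypergraph H) × e ⊆ (_∈ˡ p)
    edge⊆ p q meets q<n with em {P = ∃ λ e → e ∈ E (hypergraph H) × e ⊆ (_∈ˡ p)}
    ... | yes found = found
    ... | no  ¬found = ⊥-elim (¬colorable (split-colorable (hypergraph H) _≟_ p q meets
            (λ e∈E e⊆p → ¬found (_ , e∈E , e⊆p))
            (λ e∈E e⊆q → <⇒≱ q<n (hasSize-⊆⇒≤length (uniform e∈E) e⊆q))))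

    meets-∪ : a ∈ A → b ∈ B → a ⊆ (_∈ˡ xs) → b ⊆ (_∈ˡ xs) →
      e ∈ E (hypergraph H) → e ≬ (_∈ˡ xs)
    meets-∪ a∈A b∈B a⊆xs b⊆xs (inj₁ e∈A) = let v , v∈e , v∈b = cross e∈A b∈B in v , v∈e , b⊆xs v∈b
    meets-∪ a∈A b∈B a⊆xs b⊆xs (inj₂ e∈B) = let v , v∈a , v∈e = cross a∈A e∈B in v , v∈e , a⊆xs v∈a

  module Uniform≥2 (m : ℕ) (H : CrossIntersectingFamily)
    (uniform : Uniform (2 + m) (hypergraph H))
    (¬colorable : ¬ Colorable (hypergraph H) 3) where

    open CrossIntersectingFamily H hiding (hypergraph)
    open NotColorable (2 + m) H uniform ¬colorable public

    private
      variable
        a b : Pred Vertex 0ℓ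

    -- Were `u` and `v` distinct, drop `u` from `a` and `v` from `b`. Each dropped vertex survives
    -- in the other list, so the two lists still cover both edges, yet each is one vertex short of
    -- containing an edge; this contradicts `edge⊆`.
    common-unique : a ∈ A → b ∈ B → u ∈ a → u ∈ b → v ∈ a → v ∈ b → u ≡ v
    common-unique {a} {b} {u} {v} a∈A b∈B u∈a u∈b v∈a v∈b with u ≟ v
    ... | yes u≡v = u≡v
    ... | no  u≢v
      with hasSize-split (uniform (inj₁ a∈A)) u∈a | hasSize-split (uniform (inj₂ b∈B)) v∈b
    ...   | p , _ , |p| , (a⊆ , _) | q , _ , |q| , (b⊆ , _)
      with edge⊆ p q (meets-∪ a∈A b∈B a⊆p++q b⊆p++q) (s≤s (≤-reflexive |q|))
      where
      u∈q : u ∈ˡ q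
      u∈q with b⊆ u∈b
      ... | here u≡v  = ⊥-elim (u≢v u≡v)
      ... | there u∈q = u∈q

      v∈p : v ∈ˡ p
      v∈p with a⊆ v∈a
      ... | here v≡u  = ⊥-elim (u≢v (sym v≡u))
      ... | there v∈p = v∈p

      a⊆p++q : a ⊆ (_∈ˡ p ++ q)
      a⊆p++q w∈a with a⊆ w∈a
      ... | here refl = ∈-++⁺ʳ p u∈q
      ... | there w∈p = ∈-++⁺ˡ w∈p

      b⊆p++q : b ⊆ (_∈ˡ p ++ q)
      b⊆p++q w∈b with b⊆ w∈b
      ... | here refl = ∈-++⁺ˡ v∈p
      ... | there w∈q = ∈-++⁺ʳ p w∈q
    ...     | e , e∈E , e⊆p =
      ⊥-elim (<⇒≱ (s≤s (≤-reflexive |p|)) (hasSize-⊆⇒≤length (uniform e∈E) e⊆p))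

  -- The case of uniformity at least three.

  colorable-n≥3 : (m : ℕ) (H : CrossIntersectingFamily) →
    Uniform (3 + m) (hypergraph H) → ¬ ¬ Colorable (hypergraph H) 3
  colorable-n≥3 m H uniform ¬colorable = contradictory
    where
    open CrossIntersectingFamily H hiding (hypergraph)
    open Uniform≥2 (1 + m) H uniform ¬colorable

    contradictory : ⊥
    contradictory with A-nonempty | B-nonempty
    ... | a , a∈A | b , b∈B with cross a∈A b∈B
    ... | v , v∈a , v∈b
      with hasSize-split (uniform (inj₁ a∈A)) v∈a | hasSize-split (uniform (inj₂ b∈B)) v∈b
    ... | x₁ ∷ x₂ ∷ xs , ((_ ∷ v≢x₂ ∷ _) ∷ _) , |xs| , (a⊆ , ⊆a)
        | y₁ ∷ y₂ ∷ ys , ((_ ∷ v≢y₂ ∷ _) ∷ _) , |ys| , (b⊆ , ⊆b)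
      -- Starting from `a` and the rest of `b`, exchange `x₁` for `y₂`. The first list then has
      -- `3 + m` entries, among them `v`, `x₂` and `y₂`; the second has `2 + m`, too few for an
      -- edge.
      with edge⊆ (v ∷ x₂ ∷ y₂ ∷ xs) (x₁ ∷ y₁ ∷ ys) (meets-∪ a∈A b∈B a⊆pq b⊆pq)
             (s≤s (≤-reflexive |ys|))
      where
      a⊆pq : a ⊆ (_∈ˡ v ∷ x₂ ∷ y₂ ∷ xs ++ x₁ ∷ y₁ ∷ ys)
      a⊆pq w∈a with a⊆ w∈a
      ... | here refl                 = here refl
      ... | there (here refl)         = there (there (there (∈-++⁺ʳ xs (here refl))))
      ... | there (there (here refl)) = there (here refl)
      ... | there (there (there w∈))  = there (there (there (∈-++⁺ˡ w∈)))

      b⊆pq : b ⊆ (_∈ˡ v ∷ x₂ ∷ y₂ ∷ xs ++ x₁ ∷ y₁ ∷ ys)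
      b⊆pq w∈b with b⊆ w∈b
      ... | here refl                 = here refl
      ... | there (here refl)         = there (there (there (∈-++⁺ʳ xs (there (here refl)))))
      ... | there (there (here refl)) = there (there (here refl))
      ... | there (there (there w∈))  = there (there (there (∈-++⁺ʳ xs (there (there w∈)))))
    ... | e , e∈E , e⊆p = [ in-A , in-B ]′ e∈E
      where
      -- An edge of `3 + m` vertices inside a list of that length exhausts it.
      p⊆e : (_∈ˡ v ∷ x₂ ∷ y₂ ∷ xs) ⊆ e
      p⊆e = hasSize-⊆⇒⊇ _≟_
        (subst (λ k → HasSize k e) (cong ℕ.suc (sym |xs|)) (uniform e∈E)) e⊆p

      -- `e` shares `v` and `y₂` with `b`, and `v` and `x₂` with `a`, so `common-unique` excludes it
      -- from both sides.
      in-A : e ∈ A → ⊥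
      in-A e∈A = v≢y₂ (common-unique e∈A b∈B (p⊆e (here refl)) v∈b
        (p⊆e (there (there (here refl)))) (⊆b (there (there (here refl)))))

      in-B : e ∈ B → ⊥
      in-B e∈B = v≢x₂ (common-unique a∈A e∈B v∈a (p⊆e (here refl))
        (⊆a (there (there (here refl)))) (p⊆e (there (here refl))))

  -- The graph case.

  module Graph (H : CrossIntersectingFamily) (uniform : Uniform 2 (hypergraph H))
    (¬colorable : ¬ Colorable (hypergraph H) 3) where

    open CrossIntersectingFamily H hiding (hypergraph)
    open Uniform≥2 0 H uniform ¬colorable public

    -- If every edge met `p` or `q`, then `edge⊆` would put an edge with two vertices inside the
    -- one-entry list `[ p ]`.
    edgeAvoiding : ∀ p q → ∃ λ e → e ∈ E (hypergraph H) × p ∉ e × q ∉ e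
    edgeAvoiding p q with em {P = ∃ λ e → e ∈ E (hypergraph H) × p ∉ e × q ∉ e}
    ... | yes found  = found
    ... | no  ¬found with edge⊆ [ p ] [ q ] meets ≤-refl
      where
      meets : ∀ {e} → e ∈ E (hypergraph H) → e ≬ (_∈ˡ p ∷ q ∷ [])
      meets {e} e∈E with em₀ {P = p ∈ e} | em₀ {P = q ∈ e}
      ... | yes p∈e | _       = p , p∈e , here refl
      ... | no _    | yes q∈e = q , q∈e , there (here refl)
      ... | no p∉e  | no q∉e  = ⊥-elim (¬found (_ , e∈E , p∉e , q∉e))
    ...   | e , e∈E , e⊆p = ⊥-elim (<⇒≱ ≤-refl (hasSize-⊆⇒≤length (uniform e∈E) e⊆p))

    edge⊆-of-two : e ∈ E (hypergraph H) → s ∈ e → t ∈ e → s ≢ t →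
      s ∈ˡ xs → t ∈ˡ xs → e ⊆ (_∈ˡ xs)
    edge⊆-of-two e∈E s∈e t∈e s≢t s∈xs t∈xs w∈e
      with proj₁ (hasSize2-≐ _≟_ (uniform e∈E) s∈e t∈e s≢t) w∈e
    ... | here refl         = s∈xs
    ... | there (here refl) = t∈xs

    triangle⇒supported : ∀ {x y z} → x ≢ y → x ≢ z → y ≢ z →
      (_∈ˡ x ∷ y ∷ []) ∈ A → (_∈ˡ y ∷ z ∷ []) ∈ A → (_∈ˡ x ∷ z ∷ []) ∈ B →
      SupportedOnFour (hypergraph H)
    triangle⇒supported {x} {y} {z} x≢y x≢z y≢z xy∈A yz∈A xz∈B
      -- `f` misses the edge `yz` of `A`, so it lies in `A`; it must then meet `xz`, and can do so
      -- only in `x`.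
      with edgeAvoiding y z
    ... | f , inj₂ f∈B , y∉f , z∉f with cross yz∈A f∈B
    ...   | _ , here refl , y∈f         = ⊥-elim (y∉f y∈f)
    ...   | _ , there (here refl) , z∈f = ⊥-elim (z∉f z∈f)
    triangle⇒supported {x} {y} {z} x≢y x≢z y≢z xy∈A yz∈A xz∈B
        | f , inj₁ f∈A , y∉f , z∉f with cross f∈A xz∈B
    ...   | _ , z∈f , there (here refl) = ⊥-elim (z∉f z∈f)
    -- The other end `w` of `f` is the fourth vertex. `g` misses the edge `xz` of `B`, so it lies in
    -- `B`; meeting `xy` and `f` without `x` forces it to be `yw`.
    ...   | _ , x∈f , here refl with hasSize-split (uniform (inj₁ f∈A)) x∈f | edgeAvoiding x z
    ...     | _ | g , inj₁ g∈A , x∉g , z∉g with cross g∈A xz∈B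
    ...       | _ , x∈g , here refl         = ⊥-elim (x∉g x∈g)
    ...       | _ , z∈g , there (here refl) = ⊥-elim (z∉g z∈g)
    triangle⇒supported {x} {y} {z} x≢y x≢z y≢z xy∈A yz∈A xz∈B
        | f , inj₁ f∈A , y∉f , z∉f | _ , x∈f , here refl
            | w ∷ [] , ((x≢w ∷ []) ∷ _) , _ , (f⊆xw , xw⊆f) | g , inj₂ g∈B , x∉g , z∉g =
      x ∷ y ∷ z ∷ w ∷ [] ,
      ((x≢y ∷ x≢z ∷ x≢w ∷ []) ∷ (y≢z ∷ y≢w ∷ []) ∷ (z≢w ∷ []) ∷ [] ∷ []) ,
      refl , supported
      where
      w∈f : w ∈ f
      w∈f = xw⊆f (there (here refl))

      y≢w : y ≢ w
      y≢w refl = y∉f w∈f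

      z≢w : z ≢ w
      z≢w refl = z∉f w∈f

      y∈g : y ∈ g
      y∈g with cross xy∈A g∈B
      ... | _ , here refl , x∈g         = ⊥-elim (x∉g x∈g)
      ... | _ , there (here refl) , y∈g = y∈g

      w∈g : w ∈ g
      w∈g with cross f∈A g∈B
      ... | _ , v∈f , v∈g with f⊆xw v∈f
      ...   | here refl         = ⊥-elim (x∉g v∈g)
      ...   | there (here refl) = v∈g

      x∈ : x ∈ˡ x ∷ y ∷ z ∷ w ∷ []
      x∈ = here refl

      y∈ : y ∈ˡ x ∷ y ∷ z ∷ w ∷ []
      y∈ = there (here refl)

      z∈ : z ∈ˡ x ∷ y ∷ z ∷ w ∷ []
      z∈ = there (there (here refl))

      w∈ : w ∈ˡ x ∷ y ∷ z ∷ w ∷ []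
      w∈ = there (there (there (here refl)))

      -- An edge of `A` meets the disjoint pairs `xz` and `yw`. An edge of `B` meets `xy`, then `yz`
      -- if it contains `x`, or `xw` if it contains `y`. Either way two of its vertices are known.
      supported : ∀ {e} → e ∈ E (hypergraph H) → e ⊆ (_∈ˡ x ∷ y ∷ z ∷ w ∷ [])
      supported (inj₁ e∈A) with cross e∈A xz∈B | cross e∈A g∈B
      ... | s , s∈e , s∈xz | t , t∈e , t∈g
        with s∈xz | proj₁ (hasSize2-≐ _≟_ (uniform (inj₂ g∈B)) y∈g w∈g y≢w) t∈g
      ...   | here refl         | here refl         = edge⊆-of-two (inj₁ e∈A) s∈e t∈e x≢y x∈ y∈
      ...   | here refl         | there (here refl) = edge⊆-of-two (inj₁ e∈A) s∈e t∈e x≢w x∈ w∈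
      ...   | there (here refl) | here refl         = edge⊆-of-two (inj₁ e∈A) t∈e s∈e y≢z y∈ z∈
      ...   | there (here refl) | there (here refl) = edge⊆-of-two (inj₁ e∈A) s∈e t∈e z≢w z∈ w∈
      supported (inj₂ e∈B) with cross xy∈A e∈B
      ... | s , here refl , s∈e with cross yz∈A e∈B
      ...   | t , here refl , t∈e         = edge⊆-of-two (inj₂ e∈B) s∈e t∈e x≢y x∈ y∈
      ...   | t , there (here refl) , t∈e = edge⊆-of-two (inj₂ e∈B) s∈e t∈e x≢z x∈ z∈
      supported (inj₂ e∈B) | s , there (here refl) , s∈e with cross f∈A e∈B
      ...   | t , t∈f , t∈e with f⊆xw t∈f
      ...     | here refl         = edge⊆-of-two (inj₂ e∈B) t∈e s∈e x≢y x∈ y∈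
      ...     | there (here refl) = edge⊆-of-two (inj₂ e∈B) s∈e t∈e y≢w y∈ w∈

    -- For each pair among the four vertices, an edge avoiding the other two can only be that pair.
    -- Conversely, uniformity makes every edge a pair.
    supported⇒K₄ : SupportedOnFour (hypergraph H) →
      hypergraph H EqualsUpToIsolatedVertices Complete 4
    supported⇒K₄ (ws@(_ ∷ _ ∷ _ ∷ _ ∷ []) , ws! , refl , supported) = record
      { to        = to
      ; injective = to-injective
      ; range     = λ v → mk⇔
          (λ (_ , e∈E , v∈e) → let v∈ws = supported e∈E v∈e in
            index v∈ws , sym (lookup-index v∈ws))
          -- `punchIn i zero` is some index other than `i`; the pair they form covers `to i`.
          (λ { (i , refl) → _ , image-edge (pair-size (punchInᵢ≢i i zero ∘ sym)) ,
                            (i , here refl , refl) })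
      ; edges     = λ f → mk⇔ image-edge edge-image
      }
      where
      to : Fin 4 → Vertex
      to = lookup ws

      to-injective : ∀ {i j} → to i ≡ to j → i ≡ j
      to-injective = unique⇒lookup-injective ws! _ _

      pair-size : ∀ {i j : Fin 4} → i ≢ j → HasSize 2 (_∈ˡ i ∷ j ∷ [])
      pair-size i≢j = _ , ((i≢j ∷ []) ∷ [] ∷ []) , refl , ((λ m∈ → m∈) , (λ m∈ → m∈))

      image-edge : ∀ {f} → HasSize 2 f → Image to f ∈ E (hypergraph H)
      image-edge {f} (i ∷ j ∷ [] , ((i≢j ∷ []) ∷ _) , _ , (f⊆ij , ij⊆f))
        with complementaryPair i j i≢j
      ... | k , l , covers with edgeAvoiding (to k) (to l)
      ...   | e , e∈E , k∉e , l∉e = Hypergraph.E-resp (hypergraph H) (e⊆image , image⊆e) e∈E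
        where
        e⊆ij : e ⊆ (_∈ˡ to i ∷ to j ∷ [])
        e⊆ij v∈e with supported e∈E v∈e
        ... | v∈ws with index v∈ws | lookup-index v∈ws
        ...   | m | refl with covers m
        ...     | here refl                         = here refl
        ...     | there (here refl)                 = there (here refl)
        ...     | there (there (here refl))         = ⊥-elim (k∉e v∈e)
        ...     | there (there (there (here refl))) = ⊥-elim (l∉e v∈e)

        e⊆image : e ⊆ Image to f
        e⊆image v∈e with e⊆ij v∈e
        ... | here refl         = i , ij⊆f (here refl) , refl
        ... | there (here refl) = j , ij⊆f (there (here refl)) , refl

        image⊆e : Image to f ⊆ e
        image⊆e (m , m∈f , refl) with f⊆ij m∈f
        ... | here refl         = hasSize-⊆⇒⊇ _≟_ (uniform e∈E) e⊆ij (here refl)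
        ... | there (here refl) = hasSize-⊆⇒⊇ _≟_ (uniform e∈E) e⊆ij (there (here refl))

      edge-image : ∀ {f} → Image to f ∈ E (hypergraph H) → HasSize 2 f
      edge-image {f} image∈E with uniform image∈E
      ... | s ∷ t ∷ [] , ((s≢t ∷ []) ∷ _) , _ , (⊆st , st⊆)
        with st⊆ (here refl) | st⊆ (there (here refl))
      ...   | i , i∈f , refl | j , j∈f , refl =
        _ , (((s≢t ∘ cong to) ∷ []) ∷ [] ∷ []) , refl , (f⊆ij , ij⊆f)
        where
        f⊆ij : f ⊆ (_∈ˡ i ∷ j ∷ [])
        f⊆ij m∈f with ⊆st (_ , m∈f , refl)
        ... | here m≡i         = here (to-injective m≡i)
        ... | there (here m≡j) = there (here (to-injective m≡j))

        ij⊆f : (_∈ˡ i ∷ j ∷ []) ⊆ f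
        ij⊆f (here refl)         = i∈f
        ij⊆f (there (here refl)) = j∈f

  graph-supported : (H : CrossIntersectingFamily) → Uniform 2 (hypergraph H) →
    ¬ Colorable (hypergraph H) 3 → SupportedOnFour (hypergraph H)
  graph-supported H uniform ¬colorable = found
    where
    open CrossIntersectingFamily H hiding (hypergraph)
    open Graph H uniform ¬colorable
    module Swapped = Graph (swap H) (uniform ∘ ⊎-swap)
      (λ (c , proper) → ¬colorable (c , proper ∘ ⊎-swap))

    found : SupportedOnFour (hypergraph H)
    found with A-nonempty | B-nonempty
    ... | a , a∈A | b , b∈B with cross a∈A b∈B
    ... | x , x∈a , x∈b
      with hasSize-split (uniform (inj₁ a∈A)) x∈a | hasSize-split (uniform (inj₂ b∈B)) x∈b
    ... | y ∷ [] , ((x≢y ∷ []) ∷ _) , _ , a≐@(a⊆ , ⊆a) | z ∷ [] , ((x≢z ∷ []) ∷ _) , _ , b≐@(b⊆ , ⊆b)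
      -- The single vertex `x` contains no edge, so the pair `yz` must be one.
      with edge⊆ (y ∷ z ∷ []) [ x ] (meets-∪ a∈A b∈B a⊆yzx b⊆yzx) ≤-refl
      where
      a⊆yzx : a ⊆ (_∈ˡ y ∷ z ∷ x ∷ [])
      a⊆yzx w∈a with a⊆ w∈a
      ... | here refl         = there (there (here refl))
      ... | there (here refl) = here refl

      b⊆yzx : b ⊆ (_∈ˡ y ∷ z ∷ x ∷ [])
      b⊆yzx w∈b with b⊆ w∈b
      ... | here refl         = there (there (here refl))
      ... | there (here refl) = there (here refl)
    ... | e , e∈E , e⊆yz = finish e∈E
      where
      y≢z : y ≢ z
      y≢z refl = x≢y (common-unique a∈A b∈B x∈a x∈b (⊆a (there (here refl))) (⊆b (there (here refl))))

      yz⊆e : (_∈ˡ y ∷ z ∷ []) ⊆ e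
      yz⊆e = hasSize-⊆⇒⊇ _≟_ (uniform e∈E) e⊆yz

      finish : e ∈ E (hypergraph H) → SupportedOnFour (hypergraph H)
      finish (inj₁ e∈A) = triangle⇒supported x≢y x≢z y≢z
        (A-resp a≐ a∈A) (A-resp (e⊆yz , yz⊆e) e∈A) (B-resp b≐ b∈B)
      -- Now `xz` and `zy` lie in `B` and `xy` in `A`: the same triangle with the two sides, and `y`
      -- and `z`, interchanged.
      finish (inj₂ e∈B) =
        let zy≐ = hasSize2-≐ _≟_ (uniform e∈E) (yz⊆e (there (here refl))) (yz⊆e (here refl)) (y≢z ∘ sym)
            ws , ws! , |ws| , supported = Swapped.triangle⇒supported x≢z x≢y (y≢z ∘ sym)
              (B-resp b≐ b∈B) (B-resp zy≐ e∈B) (A-resp a≐ a∈A)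
        in ws , ws! , |ws| , supported ∘ ⊎-swap

-- The bound `2 ≤ n` excludes `n = 1`, where an edge is monochromatic under every coloring and no
-- chromatic number exists. Excluded middle is taken at level one because colorability quantifies
-- over edges, which are predicates.
corollary1p6 : ExcludedMiddle (suc 0ℓ) → (n : ℕ) → 2 ≤ n →
    (H : CrossIntersectingFamily) → Uniform n (hypergraph H) →
    χ[ hypergraph H ]≤ 3 ⊎ (n ≡ 2 × hypergraph H EqualsUpToIsolatedVertices Complete 4)
corollary1p6 em n 2≤n H uniform with em {P = Colorable (hypergraph H) 3}
corollary1p6 em n 2≤n H uniform | yes colorable =
  inj₁ (Classical.colorable⇒χ≤ em (hypergraph H) 3 colorable)
corollary1p6 em (ℕ.suc (ℕ.suc zero)) 2≤n H uniform | no ¬colorable =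
  inj₂ (refl , Graph.supported⇒K₄ H uniform ¬colorable (graph-supported H uniform ¬colorable))
  where open Classical em
corollary1p6 em (ℕ.suc (ℕ.suc (ℕ.suc m))) 2≤n H uniform | no ¬colorable =
  ⊥-elim (Classical.colorable-n≥3 em m H uniform ¬colorable)
corollary1p6 em (ℕ.suc zero) (s≤s ()) H uniform | no _
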